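{- Let $n\ge 3$ be odd and let $k=n-2$. There is no $\mathrm{MAJ}_k\circ\mathrm{MAJ}_k$ circuit computing $\mathrm{MAJ}_n$ correctly on all inputs in $\{0,1\}^n$ in which every gate is a standard majority of $k$ inputs (that is, with all weights equal to $1$ and threshold $k/2$) and every bottom-level gate has exactly $k$ distinct variables as inputs. Explicitly: there are no sets $S_1,\dots,S_k\subseteq\{1,\dots,n\}$ (not necessarily distinct), each of size exactly $k$, such that for every $x\in\{0,1\}^n$ $$\mathrm{MAJ}_n(x)=\mathrm{MAJ}_k\big(g_1(x),\dots,g_k(x)\big),\qquad\text{where } g_j(x)=\mathrm{MAJ}_k\big((x_i)_{i\in S_j}\big).$$
   Context: For every positive integer $m$, $\mathrm{MAJ}_m(z_1,\dots,z_m)=1$ if $\sum_{i=1}^m z_i\ge m/2$, and $0$ otherwise. A $\mathrm{MAJ}_k\circ\mathrm{MAJ}_k$ circuit of the kind considered here is a depth two formula whose top gate is the standard majority of $k$ bottom-level gates, each bottom-level gate being a standard majority of $k$ variables. -}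

module Defs where

open import Data.Bool using (Bool; true; _≟_)
open import Data.Fin.Subset using (Subset; inside; outside; ∣_∣)
open import Data.Nat using (ℕ; _*_; _≤?_)
open import Data.Vec using (Vec; []; _∷_; count)
open import Relation.Nullary.Decidable using (does)

-- The threshold condition  Σᵢ zᵢ ≥ m / 2  with the denominator cleared;
-- the sum of a 0/1 vector is the number of its true entries.
MAJ : ∀ m → Vec Bool m → Bool
MAJ m z = does (m ≤? 2 * count (_≟ true) z)

-- The subfamily (xᵢ)_{i ∈ S}, listed in increasing order of i.
_↾_ : ∀ {n} → Vec Bool n → (S : Subset n) → Vec Bool ∣ S ∣
[]      ↾ []            = []
(b ∷ x) ↾ (inside  ∷ S) = b ∷ (x ↾ S)
(b ∷ x) ↾ (outside ∷ S) = x ↾ S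

gate : ∀ {n} → Subset n → Vec Bool n → Bool
gate S x = MAJ ∣ S ∣ (x ↾ S)

{-# OPTIONS --safe #-}
-- The complements of the S_j are the n − 2 edges of a multigraph on n = 2t + 1
-- vertices.  If a set Z of t + 1 vertices contains t edges, then on the indicator
-- vector of ∁ Z, which has weight t, the t gates belonging to these edges keep all
-- the ones and fire, so the circuit outputs 1 although MAJ_n is 0.
-- To find Z, call a vertex set dense if it contains at least its size minus one
-- edges.  Removing a vertex of small degree shows inductively that V is covered
-- by two dense sets, one of which has at least t + 1 vertices; removing further
-- vertices of small degree shrinks it to size t + 1 while it stays dense.

module Submission where

open import Defs
open import Data.Bool using (Bool; true; false; if_then_else_)
open import Data.Fin using (Fin; zero; suc)
import Data.Fin.Properties as Fin
open import Data.Fin.Subset using (Subset; ∣_∣; inside; outside; _∈_; _∉_; _⊆_; _⊂_; _∪_; _-_; ∁; ⊤; ⁅_⁆)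
open import Data.Fin.Subset.Properties
open import Data.Nat using (ℕ; zero; suc; _+_; _*_; _≤_; _<_; _∸_; _%_; _/_; _≤?_; z≤n; s≤s)
open import Data.Nat.DivMod using (m≡m%n+[m/n]*n)
open import Data.Nat.Properties
open import Algebra.Properties.Semiring.Sum +-*-semiring using (sum; sum-syntax; sum-cong-≗; ∑-distrib-+; ∑-comm; *-distribˡ-sum; *-distribʳ-sum)
open import Data.Nat.Tactic.RingSolver using (solve-∀)
open import Data.Product using (Σ-syntax; ∃-syntax; _×_; _,_; proj₁; proj₂)
open import Data.Sum using (_⊎_; inj₁; inj₂; [_,_]′)
open import Data.Vec using (Vec; []; _∷_; tabulate; here)
open import Data.Vec.Properties using (lookup∘tabulate; []=⇒lookup; lookup⇒[]=)
open import Function using (_∘_)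
open import Relation.Binary.PropositionalEquality using (_≡_; refl; sym; trans; cong; cong₂; subst)
open import Relation.Nullary using (¬_; Dec; yes; no; does; contradiction)
open import Relation.Nullary.Decidable using (dec-true; dec-false; _×-dec_; decidable-stable; ¬?)

-- Indicator sums and cardinalities of finite sets.

𝟙 : ∀ {a} {P : Set a} → Dec P → ℕ
𝟙 P? = if does P? then 1 else 0

sum-mono-≤ : ∀ {n} (f g : Fin n → ℕ) → (∀ i → f i ≤ g i) → sum f ≤ sum g
sum-mono-≤ {zero}  f g f≤g = z≤n
sum-mono-≤ {suc n} f g f≤g = +-mono-≤ (f≤g zero) (sum-mono-≤ (f ∘ suc) (g ∘ suc) (f≤g ∘ suc))

∣p∣≡∑𝟙 : ∀ {n} (p : Subset n) → ∣ p ∣ ≡ ∑[ i < n ] 𝟙 (i ∈? p)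
∣p∣≡∑𝟙 []            = refl
∣p∣≡∑𝟙 (inside  ∷ p) = cong suc (∣p∣≡∑𝟙 p)
∣p∣≡∑𝟙 (outside ∷ p) = ∣p∣≡∑𝟙 p

∣tabulate∣≡∑𝟙 : ∀ {n} {P : Fin n → Set} (P? : ∀ i → Dec (P i)) →
  ∣ tabulate (λ i → does (P? i)) ∣ ≡ ∑[ i < n ] 𝟙 (P? i)
∣tabulate∣≡∑𝟙 {zero}  P? = refl
∣tabulate∣≡∑𝟙 {suc n} P? with does (P? zero)
... | true  = cong suc (∣tabulate∣≡∑𝟙 (P? ∘ suc))
... | false = ∣tabulate∣≡∑𝟙 (P? ∘ suc)

∣p∪q∣≤∣p∣+∣q∣ : ∀ {n} (p q : Subset n) → ∣ p ∪ q ∣ ≤ ∣ p ∣ + ∣ q ∣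
∣p∪q∣≤∣p∣+∣q∣ []            []            = z≤n
∣p∪q∣≤∣p∣+∣q∣ (inside  ∷ p) (inside  ∷ q) = s≤s (≤-trans (∣p∪q∣≤∣p∣+∣q∣ p q) (+-monoʳ-≤ ∣ p ∣ (n≤1+n ∣ q ∣)))
∣p∪q∣≤∣p∣+∣q∣ (inside  ∷ p) (outside ∷ q) = s≤s (∣p∪q∣≤∣p∣+∣q∣ p q)
∣p∪q∣≤∣p∣+∣q∣ (outside ∷ p) (inside  ∷ q) = ≤-trans (s≤s (∣p∪q∣≤∣p∣+∣q∣ p q)) (≤-reflexive (sym (+-suc ∣ p ∣ ∣ q ∣)))
∣p∪q∣≤∣p∣+∣q∣ (outside ∷ p) (outside ∷ q) = ∣p∪q∣≤∣p∣+∣q∣ p q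

∣p∪⁅x⁆∣≤1+∣p∣ : ∀ {n} (p : Subset n) x → ∣ p ∪ ⁅ x ⁆ ∣ ≤ suc ∣ p ∣
∣p∪⁅x⁆∣≤1+∣p∣ p x = begin
  ∣ p ∪ ⁅ x ⁆ ∣      ≤⟨ ∣p∪q∣≤∣p∣+∣q∣ p ⁅ x ⁆ ⟩
  ∣ p ∣ + ∣ ⁅ x ⁆ ∣  ≡⟨ cong (∣ p ∣ +_) (∣⁅x⁆∣≡1 x) ⟩
  ∣ p ∣ + 1          ≡⟨ +-comm ∣ p ∣ 1 ⟩
  suc ∣ p ∣          ∎
  where open ≤-Reasoning

p⊆p-x∪⁅x⁆ : ∀ {n} (p : Subset n) x → p ⊆ (p - x) ∪ ⁅ x ⁆
p⊆p-x∪⁅x⁆ p x {y} y∈p with y Fin.≟ x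
... | yes refl = x∈p∪q⁺ (inj₂ (x∈⁅x⁆ x))
... | no  y≢x  = x∈p∪q⁺ (inj₁ (x∈p∧x≢y⇒x∈p-y y∈p y≢x))

x∉p-x : ∀ {n} (p : Subset n) x → x ∉ p - x
x∉p-x (_ ∷ p) (suc x) x∈ = x∉p-x p x (drop-there x∈)

p⊆q∧x∉p⇒p⊆q-x : ∀ {n} {p q : Subset n} {x} → p ⊆ q → x ∉ p → p ⊆ q - x
p⊆q∧x∉p⇒p⊆q-x p⊆q x∉p y∈p = x∈p∧x≢y⇒x∈p-y (p⊆q y∈p) λ { refl → x∉p y∈p }

∣p∣≤1+∣p-x∣ : ∀ {n} (p : Subset n) x → ∣ p ∣ ≤ suc ∣ p - x ∣
∣p∣≤1+∣p-x∣ p x = ≤-trans (p⊆q⇒∣p∣≤∣q∣ (p⊆p-x∪⁅x⁆ p x)) (∣p∪⁅x⁆∣≤1+∣p∣ (p - x) x)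

∣p∣≤1⇒x≡y : ∀ {n} {p : Subset n} → ∣ p ∣ ≤ 1 → ∀ {x y} → x ∈ p → y ∈ p → x ≡ y
∣p∣≤1⇒x≡y {p = p} ∣p∣≤1 {x} {y} x∈p y∈p with x Fin.≟ y
... | yes x≡y = x≡y
... | no  x≢y = contradiction (begin-strict
  suc ∣ p - y - x ∣  ≤⟨ x∈p⇒∣p-x∣<∣p∣ (x∈p∧x≢y⇒x∈p-y x∈p x≢y) ⟩
  ∣ p - y ∣          <⟨ x∈p⇒∣p-x∣<∣p∣ y∈p ⟩
  ∣ p ∣              ≤⟨ ∣p∣≤1 ⟩
  1                  ∎) λ { (s≤s ()) }
  where open ≤-Reasoning

-- A set with at most one element cannot be divided between `q` and `r`. It is applied to what is
-- left of an edge after one endpoint is deleted.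
∣p∣≤1∧p⊆q∪r⇒p⊆q⊎p⊆r : ∀ {n} {p : Subset n} q r → ∣ p ∣ ≤ 1 → p ⊆ q ∪ r → p ⊆ q ⊎ p ⊆ r
∣p∣≤1∧p⊆q∪r⇒p⊆q⊎p⊆r {p = p} q r ∣p∣≤1 p⊆q∪r with nonempty? p
... | no  p≡∅       = inj₁ (λ x∈p → contradiction (_ , x∈p) p≡∅)
... | yes (x , x∈p) with x∈p∪q⁻ q r (p⊆q∪r x∈p)
...   | inj₁ x∈q = inj₁ (λ y∈p → subst (_∈ q) (∣p∣≤1⇒x≡y ∣p∣≤1 x∈p y∈p) x∈q)
...   | inj₂ x∈r = inj₂ (λ y∈p → subst (_∈ r) (∣p∣≤1⇒x≡y ∣p∣≤1 x∈p y∈p) x∈r)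

-- An input vector is read as the set of its ones; restricting it to a superset discards only zeros.
-- A gate that reads all the ones thus sees the full weight of the input.
x⊆S⇒∣x↾S∣≡∣x∣ : ∀ {n} (x S : Subset n) → x ⊆ S → ∣ x ↾ S ∣ ≡ ∣ x ∣
x⊆S⇒∣x↾S∣≡∣x∣ [] [] _ = refl
x⊆S⇒∣x↾S∣≡∣x∣ (inside ∷ x) (inside ∷ S) x⊆S = cong suc (x⊆S⇒∣x↾S∣≡∣x∣ x S (drop-∷-⊆ x⊆S))
x⊆S⇒∣x↾S∣≡∣x∣ (outside ∷ x) (inside ∷ S) x⊆S = x⊆S⇒∣x↾S∣≡∣x∣ x S (drop-∷-⊆ x⊆S)
x⊆S⇒∣x↾S∣≡∣x∣ (inside ∷ x) (outside ∷ S) x⊆S = contradiction (x⊆S here) λ ()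
x⊆S⇒∣x↾S∣≡∣x∣ (outside ∷ x) (outside ∷ S) x⊆S = x⊆S⇒∣x↾S∣≡∣x∣ x S (drop-∷-⊆ x⊆S)

m+n≤m⇒n≡0 : ∀ m {n} → m + n ≤ m → n ≡ 0
m+n≤m⇒n≡0 m {n} m+n≤m = n≤0⇒n≡0 (+-cancelˡ-≤ m n 0 (≤-trans m+n≤m (≤-reflexive (sym (+-identityʳ m)))))

-- Induced edge counts and low-degree vertices of a multigraph.

module Graph {n k : ℕ} (T : Fin k → Subset n) (∣T∣≤2 : ∀ j → ∣ T j ∣ ≤ 2) where

  -- Edges are collected by index, so parallel edges count separately.
  within : Subset n → Subset k
  within Y = tabulate (λ j → does (T j ⊆? Y))

  e : Subset n → ℕ
  e Y = ∣ within Y ∣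

  ∈within⁺ : ∀ Y {j} → T j ⊆ Y → j ∈ within Y
  ∈within⁺ Y {j} Tj⊆Y = lookup⇒[]= j (within Y)
    (trans (lookup∘tabulate _ j) (dec-true (T j ⊆? Y) Tj⊆Y))

  ∈within⁻ : ∀ Y {j} → j ∈ within Y → T j ⊆ Y
  ∈within⁻ Y {j} j∈ = decidable-stable (T j ⊆? Y) λ ¬Tj⊆Y →
    contradiction (trans (sym ([]=⇒lookup j∈))
      (trans (lookup∘tabulate _ j) (dec-false (T j ⊆? Y) ¬Tj⊆Y))) λ ()

  within-mono : ∀ {Y Z} → Y ⊆ Z → within Y ⊆ within Z
  within-mono {Y} {Z} Y⊆Z j∈ = ∈within⁺ Z (Y⊆Z ∘ ∈within⁻ Y j∈)

  private
    χ : Subset n → Fin n → ℕ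
    χ Y v = 𝟙 (v ∈? Y)

    ε : Subset n → Fin k → ℕ
    ε Y j = 𝟙 (T j ⊆? Y)

  -- An edge inside `Y` survives the deletion of every vertex except its own, of which there are at
  -- most two.
  edge-count : ∀ Y j → ∣ Y ∣ * ε Y j ≤ ∑[ v < n ] (χ Y v * ε (Y - v) j) + 2 * ε Y j
  edge-count Y j with T j ⊆? Y
  ... | no  _    = ≤-trans (≤-reflexive (*-zeroʳ ∣ Y ∣)) z≤n
  ... | yes Tj⊆Y = begin
    ∣ Y ∣ * 1                                        ≡⟨ *-identityʳ ∣ Y ∣ ⟩
    ∣ Y ∣                                            ≡⟨ ∣p∣≡∑𝟙 Y ⟩
    ∑[ v < n ] χ Y v                                 ≤⟨ sum-mono-≤ _ _ pointwise ⟩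
    ∑[ v < n ] (χ Y v * ε (Y - v) j + χ (T j) v)     ≡⟨ ∑-distrib-+ (λ v → χ Y v * ε (Y - v) j) (χ (T j)) ⟩
    ∑[ v < n ] (χ Y v * ε (Y - v) j) + sum (χ (T j)) ≡⟨ cong (sum (λ v → χ Y v * ε (Y - v) j) +_) (sym (∣p∣≡∑𝟙 (T j))) ⟩
    ∑[ v < n ] (χ Y v * ε (Y - v) j) + ∣ T j ∣       ≤⟨ +-monoʳ-≤ (sum (λ v → χ Y v * ε (Y - v) j)) (∣T∣≤2 j) ⟩
    ∑[ v < n ] (χ Y v * ε (Y - v) j) + 2             ∎
    where
    open ≤-Reasoning
    pointwise : ∀ v → χ Y v ≤ χ Y v * ε (Y - v) j + χ (T j) v
    pointwise v with v ∈? Y | T j ⊆? (Y - v) | v ∈? T j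
    ... | no  _ | _     | _        = z≤n
    ... | yes _ | yes _ | _        = s≤s z≤n
    ... | yes _ | no  _ | yes _    = s≤s z≤n
    ... | yes _ | no Tj⊈Y-v | no v∉Tj =
      contradiction (λ {x} → p⊆q∧x∉p⇒p⊆q-x Tj⊆Y v∉Tj {x}) Tj⊈Y-v

  -- Summing `edge-count` over the edges and exchanging the sums gives the handshake bound: the
  -- degrees `e Y ∸ e (Y - v)` over `Y` add up to at most `2 * e Y`. The form chosen avoids
  -- subtraction.
  double-count : ∀ Y → ∣ Y ∣ * e Y ≤ ∑[ v < n ] (χ Y v * e (Y - v)) + 2 * e Y
  double-count Y = begin
    ∣ Y ∣ * e Y
      ≡⟨ cong (∣ Y ∣ *_) (e≡∑ε Y) ⟩
    ∣ Y ∣ * sum (ε Y)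
      ≡⟨ *-distribˡ-sum ∣ Y ∣ (ε Y) ⟩
    ∑[ j < k ] (∣ Y ∣ * ε Y j)
      ≤⟨ sum-mono-≤ _ _ (edge-count Y) ⟩
    ∑[ j < k ] (∑[ v < n ] (χ Y v * ε (Y - v) j) + 2 * ε Y j)
      ≡⟨ ∑-distrib-+ (λ j → ∑[ v < n ] (χ Y v * ε (Y - v) j)) (λ j → 2 * ε Y j) ⟩
    ∑[ j < k ] ∑[ v < n ] (χ Y v * ε (Y - v) j) + ∑[ j < k ] (2 * ε Y j)
      ≡⟨ cong₂ _+_ (sym (∑-comm (λ v j → χ Y v * ε (Y - v) j))) (sym (*-distribˡ-sum 2 (ε Y))) ⟩
    ∑[ v < n ] ∑[ j < k ] (χ Y v * ε (Y - v) j) + 2 * sum (ε Y)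
      ≡⟨ cong₂ _+_ (sum-cong-≗ (λ v → trans (sym (*-distribˡ-sum (χ Y v) (ε (Y - v))))
                                        (cong (χ Y v *_) (sym (e≡∑ε (Y - v))))))
                   (cong (2 *_) (sym (e≡∑ε Y))) ⟩
    ∑[ v < n ] (χ Y v * e (Y - v)) + 2 * e Y
      ∎
    where
    open ≤-Reasoning
    e≡∑ε : ∀ Z → e Z ≡ sum (ε Z)
    e≡∑ε Z = ∣tabulate∣≡∑𝟙 (λ j → T j ⊆? Z)

  -- Averaging: otherwise the degree sum over Y would exceed twice its number of edges.
  ∃-low-degree : ∀ Y c → 2 ≤ ∣ Y ∣ → ∣ Y ∣ ≤ e Y + suc c →
    ∃[ v ] (v ∈ Y × ∣ Y ∣ ≤ suc (e (Y - v) + suc c))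
  ∃-low-degree Y c 2≤m m≤e+c
    with Fin.any? (λ v → (v ∈? Y) ×-dec (∣ Y ∣ ≤? suc (e (Y - v) + suc c)))
  ... | yes found = found
  -- The two ends of the chain differ by `2 * suc c`, so the contradiction comes from the slack
  -- `suc c` being positive.
  ... | no  none  = contradiction (m+n≤m⇒n≡0 (m * m + 2 * e Y) (begin
    m * m + 2 * e Y + 2 * suc c                        ≡⟨ regroup₁ (m * m) (e Y) (suc c) ⟩
    m * m + 2 * (e Y + suc c)                          ≡⟨ cong (λ z → m * m + 2 * z) (sym m+d≡e+c) ⟩
    m * m + 2 * (m + d)                                ≡⟨ regroup₂ m d ⟩
    -- The surplus `d` of edges plus slack over vertices is absorbed because `Y` has at least two
    -- vertices.
    m * m + 2 * m + 2 * d                              ≤⟨ +-monoʳ-≤ (m * m + 2 * m) (*-monoˡ-≤ d 2≤m) ⟩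
    m * m + 2 * m + m * d                              ≡⟨ regroup₃ m d ⟩
    m * (m + d) + m * 2                                ≡⟨ cong (λ z → m * z + m * 2) m+d≡e+c ⟩
    m * (e Y + suc c) + m * 2                          ≡⟨ regroup₄ m (e Y) (suc c) ⟩
    m * e Y + m * (suc c + 2)                          ≤⟨ +-monoˡ-≤ (m * (suc c + 2)) (double-count Y) ⟩
    ∑[ v < n ] (χ Y v * e (Y - v)) + 2 * e Y + m * (suc c + 2)
      ≡⟨ regroup₅ (sum (λ v → χ Y v * e (Y - v))) (2 * e Y) (m * (suc c + 2)) ⟩
    ∑[ v < n ] (χ Y v * e (Y - v)) + m * (suc c + 2) + 2 * e Y
      ≤⟨ +-monoˡ-≤ (2 * e Y) total ⟩
    m * m + 2 * e Y                                    ∎)) λ ()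
    where
    open ≤-Reasoning
    m d : ℕ
    m = ∣ Y ∣
    d = (e Y + suc c) ∸ m
    m+d≡e+c : m + d ≡ e Y + suc c
    m+d≡e+c = m+[n∸m]≡n m≤e+c
    regroup₁ : ∀ x y z → x + 2 * y + 2 * z ≡ x + 2 * (y + z)
    regroup₁ = solve-∀
    regroup₂ : ∀ x y → x * x + 2 * (x + y) ≡ x * x + 2 * x + 2 * y
    regroup₂ = solve-∀
    regroup₃ : ∀ x y → x * x + 2 * x + x * y ≡ x * (x + y) + x * 2
    regroup₃ = solve-∀
    regroup₄ : ∀ x y z → x * (y + z) + x * 2 ≡ x * y + x * (z + 2)
    regroup₄ = solve-∀
    regroup₅ : ∀ x y z → x + y + z ≡ x + z + y
    regroup₅ = solve-∀
    pointwise : ∀ v → χ Y v * e (Y - v) + χ Y v * (suc c + 2) ≤ χ Y v * m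
    pointwise v with v ∈? Y
    ... | no  _   = z≤n
    ... | yes v∈Y = begin
      1 * e (Y - v) + 1 * (suc c + 2) ≡⟨ regroup₆ (e (Y - v)) (suc c) ⟩
      suc (suc (e (Y - v) + suc c))   ≤⟨ ≰⇒> (λ m≤ → none (v , v∈Y , m≤)) ⟩
      m                               ≡⟨ sym (*-identityˡ m) ⟩
      1 * m                           ∎
      where
      regroup₆ : ∀ x y → 1 * x + 1 * (y + 2) ≡ suc (suc (x + y))
      regroup₆ = solve-∀
    ∑χ* : ∀ b → ∑[ v < n ] (χ Y v * b) ≡ m * b
    ∑χ* b = trans (sym (*-distribʳ-sum b (χ Y))) (cong (_* b) (sym (∣p∣≡∑𝟙 Y)))
    total : ∑[ v < n ] (χ Y v * e (Y - v)) + m * (suc c + 2) ≤ m * m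
    total = begin
      ∑[ v < n ] (χ Y v * e (Y - v)) + m * (suc c + 2)
        ≡⟨ cong (sum (λ v → χ Y v * e (Y - v)) +_) (sym (∑χ* (suc c + 2))) ⟩
      ∑[ v < n ] (χ Y v * e (Y - v)) + ∑[ v < n ] (χ Y v * (suc c + 2))
        ≡⟨ sym (∑-distrib-+ (λ v → χ Y v * e (Y - v)) (λ v → χ Y v * (suc c + 2))) ⟩
      ∑[ v < n ] (χ Y v * e (Y - v) + χ Y v * (suc c + 2))
        ≤⟨ sum-mono-≤ _ _ pointwise ⟩
      ∑[ v < n ] (χ Y v * m)
        ≡⟨ ∑χ* m ⟩
      m * m ∎

  -- Dense vertex sets and coverings by two of them.

  Dense : Subset n → Set
  Dense Y = ∣ Y ∣ ≤ e Y + 1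

  -- Slack 1, the case `c = 0` of `∃-low-degree`, is exactly density, so deleting the vertex found
  -- there keeps the set dense. As `1 ≤ s`, at least two vertices are present before each of the `d`
  -- deletions.
  shrink : ∀ s d Y → 1 ≤ s → ∣ Y ∣ ≡ d + s → Dense Y → ∃[ Z ] (∣ Z ∣ ≡ s × Dense Z)
  shrink s zero    Y 1≤s ∣Y∣≡s dense = Y , ∣Y∣≡s , dense
  shrink s (suc d) Y 1≤s ∣Y∣≡  dense
    with v , v∈Y , low ← ∃-low-degree Y 0
           (≤-trans (s≤s (≤-trans 1≤s (m≤n+m s d))) (≤-reflexive (sym ∣Y∣≡))) dense
    = shrink s d (Y - v) 1≤s
        (suc-injective (trans (≤-antisym (x∈p⇒∣p-x∣<∣p∣ v∈Y) (∣p∣≤1+∣p-x∣ Y v)) ∣Y∣≡))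
        (≤-pred (≤-trans (x∈p⇒∣p-x∣<∣p∣ v∈Y) low))

  -- One vertex is added, and at least one edge with it: edge `j` contains `v`, so it was not inside
  -- `C` before.
  Dense-extend : ∀ {C v j} → v ∉ C → v ∈ T j → T j - v ⊆ C → Dense C → Dense (C ∪ ⁅ v ⁆)
  Dense-extend {C} {v} {j} v∉C v∈Tj Tj-v⊆C dense = begin
    ∣ C ∪ ⁅ v ⁆ ∣       ≤⟨ ∣p∪⁅x⁆∣≤1+∣p∣ C v ⟩
    suc ∣ C ∣           ≤⟨ s≤s dense ⟩
    suc (e C) + 1       ≤⟨ +-monoˡ-≤ 1 (p⊂q⇒∣p∣<∣q∣ within⊂) ⟩
    e (C ∪ ⁅ v ⁆) + 1   ∎
    where
    open ≤-Reasoning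
    Tj⊆ : T j ⊆ C ∪ ⁅ v ⁆
    Tj⊆ x∈Tj with x∈p∪q⁻ (T j - v) ⁅ v ⁆ (p⊆p-x∪⁅x⁆ (T j) v x∈Tj)
    ... | inj₁ x∈Tj-v = x∈p∪q⁺ (inj₁ (Tj-v⊆C x∈Tj-v))
    ... | inj₂ x∈⁅v⁆  = x∈p∪q⁺ (inj₂ x∈⁅v⁆)
    within⊂ : within C ⊂ within (C ∪ ⁅ v ⁆)
    within⊂ = within-mono (p⊆p∪q ⁅ v ⁆) , j , ∈within⁺ (C ∪ ⁅ v ⁆) Tj⊆ , λ j∈ → v∉C (∈within⁻ C j∈ v∈Tj)

  -- C and D need not be disjoint: a dense Y is split as Y ∪ Y.
  record Split (Y : Subset n) : Set where
    field
      C D     : Subset n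
      C⊆Y     : C ⊆ Y
      D⊆Y     : D ⊆ Y
      Y⊆C∪D   : Y ⊆ C ∪ D
      C-dense : Dense C
      D-dense : Dense D

  swap : ∀ {Y} → Split Y → Split Y
  swap s = record
    { C = D ; D = C ; C⊆Y = D⊆Y ; D⊆Y = C⊆Y
    ; Y⊆C∪D = λ x∈Y → subst (_ ∈_) (∪-comm C D) (Y⊆C∪D x∈Y)
    ; C-dense = D-dense ; D-dense = C-dense }
    where open Split s

  -- The deleted vertex is put back into the part that contains the rest of edge `j`; the other part
  -- stays as it is.
  extend : ∀ {Y v j} → v ∈ Y → v ∈ T j → (s : Split (Y - v)) → T j - v ⊆ Split.C s → Split Y
  extend {Y} {v} v∈Y v∈Tj s Tj-v⊆C = record
    { C = C ∪ ⁅ v ⁆ ; D = D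
    ; C⊆Y = [ Y-v⊆Y ∘ C⊆Y , (λ x∈⁅v⁆ → subst (_∈ Y) (sym (x∈⁅y⁆⇒x≡y v x∈⁅v⁆)) v∈Y) ]′ ∘ x∈p∪q⁻ C ⁅ v ⁆
    ; D⊆Y = Y-v⊆Y ∘ D⊆Y
    ; Y⊆C∪D = λ x∈Y → cover (x∈p∪q⁻ (Y - v) ⁅ v ⁆ (p⊆p-x∪⁅x⁆ Y v x∈Y))
    ; C-dense = Dense-extend (x∉p-x Y v ∘ C⊆Y) v∈Tj Tj-v⊆C C-dense
    ; D-dense = D-dense }
    where
    open Split s
    Y-v⊆Y : Y - v ⊆ Y
    Y-v⊆Y = p─q⊆p Y ⁅ v ⁆
    cover : ∀ {x} → x ∈ Y - v ⊎ x ∈ ⁅ v ⁆ → x ∈ (C ∪ ⁅ v ⁆) ∪ D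
    cover (inj₂ x∈⁅v⁆) = x∈p∪q⁺ (inj₁ (x∈p∪q⁺ (inj₂ x∈⁅v⁆)))
    cover (inj₁ x∈Y-v) with x∈p∪q⁻ C D (Y⊆C∪D x∈Y-v)
    ... | inj₁ x∈C = x∈p∪q⁺ (inj₁ (x∈p∪q⁺ (inj₁ x∈C)))
    ... | inj₂ x∈D = x∈p∪q⁺ (inj₂ x∈D)

  ∃-lost-edge : ∀ {Y Z} → e Z < e Y → ∃[ j ] (T j ⊆ Y × ¬ T j ⊆ Z)
  ∃-lost-edge {Y} {Z} eZ<eY with Fin.any? (λ j → (T j ⊆? Y) ×-dec ¬? (T j ⊆? Z))
  ... | yes found = found
  ... | no  none  = contradiction eZ<eY (≤⇒≯ (p⊆q⇒∣p∣≤∣q∣ {p = within Y} {q = within Z} λ {j} j∈ →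
    ∈within⁺ Z (decidable-stable (T j ⊆? Z) λ ⊈ → none (j , ∈within⁻ Y j∈ , ⊈))))

  -- Induction on the size of `Y`, with `m` as a bound that decreases structurally. The invariant is
  -- slack 2, one more than density allows.
  split : ∀ m Y → ∣ Y ∣ ≤ m → ∣ Y ∣ ≤ e Y + 2 → Split Y
  split m Y ∣Y∣≤m ∣Y∣≤e+2 with ∣ Y ∣ ≤? e Y + 1
  ... | yes dense = record
    { C = Y ; D = Y ; C⊆Y = λ x∈ → x∈ ; D⊆Y = λ x∈ → x∈ ; Y⊆C∪D = p⊆p∪q Y ; C-dense = dense ; D-dense = dense }
  split zero Y ∣Y∣≤0 _ | no ¬dense = contradiction (≤-trans ∣Y∣≤0 z≤n) ¬dense
  split (suc m) Y ∣Y∣≤m ∣Y∣≤e+2 | no ¬dense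
    -- Failure of density gives `e Y + 2 ≤ ∣ Y ∣`, hence two vertices; `c = 1` makes the slack 2,
    -- which passes to `Y - v`.
    with v , v∈Y , low ← ∃-low-degree Y 1
           (≤-trans (s≤s (m≤n+m 1 (e Y))) (≰⇒> ¬dense)) ∣Y∣≤e+2
    with e Y ≤? e (Y - v)
  -- No edge inside `Y` is lost, so `Y - v` has one vertex fewer and as many edges: its slack drops
  -- to 1. The single vertex `v` is dense even without edges.
  ... | yes eY≤ = record
    { C = ⁅ v ⁆ ; D = Y - v
    ; C⊆Y = λ x∈⁅v⁆ → subst (_∈ Y) (sym (x∈⁅y⁆⇒x≡y v x∈⁅v⁆)) v∈Y
    ; D⊆Y = p─q⊆p Y ⁅ v ⁆
    ; Y⊆C∪D = λ x∈Y → subst (_ ∈_) (∪-comm (Y - v) ⁅ v ⁆) (p⊆p-x∪⁅x⁆ Y v x∈Y)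
    ; C-dense = ≤-trans (≤-reflexive (∣⁅x⁆∣≡1 v)) (m≤n+m 1 (e ⁅ v ⁆))
    ; D-dense = ≤-pred (begin
        suc ∣ Y - v ∣         ≤⟨ x∈p⇒∣p-x∣<∣p∣ v∈Y ⟩
        ∣ Y ∣                 ≤⟨ ∣Y∣≤e+2 ⟩
        e Y + 2               ≤⟨ +-monoˡ-≤ 2 eY≤ ⟩
        e (Y - v) + 2         ≡⟨ +-suc (e (Y - v)) 1 ⟩
        suc (e (Y - v) + 1)   ∎) }
    where open ≤-Reasoning
  -- A lost edge must contain `v`, and its remaining vertex, if any, lies in one of the two parts
  -- covering `Y - v`; `v` joins that part.
  ... | no  eY≰ with j , Tj⊆Y , Tj⊈Y-v ← ∃-lost-edge {Y} {Y - v} (≰⇒> eY≰)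
    = [ extend v∈Y v∈Tj rest , extend v∈Y v∈Tj (swap rest) ]′
        (∣p∣≤1∧p⊆q∪r⇒p⊆q⊎p⊆r C D ∣Tj-v∣≤1 (Y⊆C∪D ∘ Tj-v⊆Y-v))
    where
    v∈Tj : v ∈ T j
    v∈Tj = decidable-stable (v ∈? T j) (Tj⊈Y-v ∘ p⊆q∧x∉p⇒p⊆q-x Tj⊆Y)
    ∣Tj-v∣≤1 : ∣ T j - v ∣ ≤ 1
    ∣Tj-v∣≤1 = ≤-pred (≤-trans (x∈p⇒∣p-x∣<∣p∣ v∈Tj) (∣T∣≤2 j))
    Tj-v⊆Y-v : T j - v ⊆ Y - v
    Tj-v⊆Y-v x∈ = p⊆q∧x∉p⇒p⊆q-x (Tj⊆Y ∘ p─q⊆p (T j) ⁅ v ⁆) (x∉p-x (T j) v) x∈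
    rest : Split (Y - v)
    rest = split m (Y - v) (≤-pred (≤-trans (x∈p⇒∣p-x∣<∣p∣ v∈Y) ∣Y∣≤m))
      (≤-pred (≤-trans (x∈p⇒∣p-x∣<∣p∣ v∈Y) low))
    open Split rest

  -- A dense set of prescribed size.

  e⊤≡k : e ⊤ ≡ k
  e⊤≡k = ≤-antisym (∣p∣≤n (within ⊤))
    (≤-trans (≤-reflexive (sym (∣⊤∣≡n k))) (p⊆q⇒∣p∣≤∣q∣ {p = ⊤} {q = within ⊤} λ {j} _ → ∈within⁺ ⊤ {j} ⊆⊤))

  -- If both covering sets had fewer than `s` vertices, together they would have at most
  -- `2 * s - 2`, which is less than `n`. So one is large enough to be shrunk to size `s`.
  ∃-dense : ∀ s → 1 ≤ s → 2 * s ≤ suc n → n ≤ k + 2 → ∃[ Z ] (∣ Z ∣ ≡ s × Dense Z)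
  ∃-dense s 1≤s 2s≤1+n n≤k+2 = larger (s ≤? ∣ C ∣) (s ≤? ∣ D ∣)
    where
    open ≤-Reasoning
    open Split (split n ⊤ (∣p∣≤n {n} ⊤) (begin
      ∣ ⊤ {n} ∣  ≤⟨ ∣p∣≤n {n} ⊤ ⟩
      n          ≤⟨ n≤k+2 ⟩
      k + 2      ≡⟨ cong (_+ 2) (sym e⊤≡k) ⟩
      e ⊤ + 2    ∎))
    larger : Dec (s ≤ ∣ C ∣) → Dec (s ≤ ∣ D ∣) → ∃[ Z ] (∣ Z ∣ ≡ s × Dense Z)
    larger (yes s≤C) _         = shrink s (∣ C ∣ ∸ s) C 1≤s (sym (m∸n+n≡m s≤C)) C-dense
    larger (no _)    (yes s≤D) = shrink s (∣ D ∣ ∸ s) D 1≤s (sym (m∸n+n≡m s≤D)) D-dense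
    larger (no s≰C)  (no s≰D)  = contradiction 2s≤1+n (<⇒≱ (begin
      suc (suc n)                ≡⟨ cong (2 +_) (sym (∣⊤∣≡n n)) ⟩
      suc (suc ∣ ⊤ {n} ∣)        ≤⟨ s≤s (s≤s (p⊆q⇒∣p∣≤∣q∣ Y⊆C∪D)) ⟩
      suc (suc ∣ C ∪ D ∣)        ≤⟨ s≤s (s≤s (∣p∪q∣≤∣p∣+∣q∣ C D)) ⟩
      suc (suc (∣ C ∣ + ∣ D ∣))  ≡⟨ cong suc (sym (+-suc ∣ C ∣ ∣ D ∣)) ⟩
      suc ∣ C ∣ + suc ∣ D ∣      ≤⟨ +-mono-≤ (≰⇒> s≰C) (≰⇒> s≰D) ⟩
      s + s                      ≡⟨ cong (s +_) (sym (+-identityʳ s)) ⟩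
      2 * s                      ∎))

-- The input on which the circuit errs.

no-circuit : ∀ t → let n = 3 + t * 2; k = 1 + t * 2 in
  (S : Fin k → Subset n) → (∀ j → ∣ S j ∣ ≡ k) →
  ¬ (∀ x → MAJ n x ≡ MAJ k (tabulate (λ j → gate (S j) x)))
no-circuit t S ∣S∣≡k correct = contradiction (trans (sym MAJₙ≡false) (trans (correct x) MAJₖ≡true)) λ ()
  where
  open ≤-Reasoning
  n k : ℕ
  n = 3 + t * 2
  k = 1 + t * 2
  ∣∁S∣≤2 : ∀ j → ∣ ∁ (S j) ∣ ≤ 2
  ∣∁S∣≤2 j = ≤-reflexive (trans (∣∁p∣≡n∸∣p∣ (S j)) (trans (cong (n ∸_) (∣S∣≡k j)) (m+n∸n≡m 2 (t * 2))))
  open Graph (λ j → ∁ (S j)) ∣∁S∣≤2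
  -- Since `n = 3 + t * 2`, the least majority size is `2 + t`; a dense set of that size contains at
  -- least `1 + t` edges and leaves `1 + t` vertices outside.
  dense-half : ∃[ Z ] (∣ Z ∣ ≡ 2 + t × Dense Z)
  dense-half = ∃-dense (2 + t) (s≤s z≤n)
    (≤-reflexive (double t)) (≤-reflexive (+-comm 2 k))
    where
    double : ∀ t → 2 * (2 + t) ≡ 4 + t * 2
    double = solve-∀
  Z : Subset n
  Z = proj₁ dense-half
  ∣Z∣≡2+t : ∣ Z ∣ ≡ 2 + t
  ∣Z∣≡2+t = proj₁ (proj₂ dense-half)
  t<eZ : t < e Z
  t<eZ = ≤-pred (begin
    2 + t    ≡⟨ sym ∣Z∣≡2+t ⟩
    ∣ Z ∣    ≤⟨ proj₂ (proj₂ dense-half) ⟩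
    e Z + 1  ≡⟨ +-comm (e Z) 1 ⟩
    suc (e Z) ∎)
  x : Vec Bool n
  x = ∁ Z
  ∣x∣≡1+t : ∣ x ∣ ≡ 1 + t
  ∣x∣≡1+t = trans (∣∁p∣≡n∸∣p∣ Z) (trans (cong (n ∸_) ∣Z∣≡2+t)
    (trans (cong (_∸ (2 + t)) (split-off t)) (m+n∸n≡m (1 + t) (2 + t))))
    where
    split-off : ∀ t → 3 + t * 2 ≡ 1 + t + (2 + t)
    split-off = solve-∀
  -- This value decides all thresholds: `1 + t` ones reach the threshold of a gate on `k` inputs but
  -- not that of `MAJ n`, where `n = 2 + k`.
  2[1+t]≡1+k : 2 * (1 + t) ≡ 1 + k
  2[1+t]≡1+k = *-comm 2 (1 + t)
  MAJₙ≡false : MAJ n x ≡ false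
  MAJₙ≡false = dec-false (n ≤? 2 * ∣ x ∣)
    (<⇒≱ (s≤s (≤-reflexive (trans (cong (2 *_) ∣x∣≡1+t) 2[1+t]≡1+k))))
  gate≡true : ∀ j → ∁ (S j) ⊆ Z → gate (S j) x ≡ true
  gate≡true j ∁Sj⊆Z = dec-true (∣ S j ∣ ≤? 2 * ∣ x ↾ S j ∣) (begin
    ∣ S j ∣           ≡⟨ ∣S∣≡k j ⟩
    k                 ≤⟨ n≤1+n k ⟩
    1 + k             ≡⟨ sym 2[1+t]≡1+k ⟩
    2 * (1 + t)       ≡⟨ cong (2 *_) (sym ∣x∣≡1+t) ⟩
    2 * ∣ x ∣         ≡⟨ cong (2 *_) (sym (x⊆S⇒∣x↾S∣≡∣x∣ x (S j) x⊆Sj)) ⟩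
    2 * ∣ x ↾ S j ∣   ∎)
    where
    x⊆Sj : x ⊆ S j
    x⊆Sj i∈x = x∉∁p⇒x∈p (x∈∁p⇒x∉p i∈x ∘ ∁Sj⊆Z)
  gates : Subset k
  gates = tabulate (λ j → gate (S j) x)
  within⊆gates : within Z ⊆ gates
  within⊆gates {j} j∈ = lookup⇒[]= j gates (trans (lookup∘tabulate (λ i → gate (S i) x) j) (gate≡true j (∈within⁻ Z j∈)))
  MAJₖ≡true : MAJ k gates ≡ true
  MAJₖ≡true = dec-true (k ≤? 2 * ∣ gates ∣) (begin
    k              ≤⟨ n≤1+n k ⟩
    1 + k          ≡⟨ sym 2[1+t]≡1+k ⟩
    2 * (1 + t)    ≤⟨ *-monoʳ-≤ 2 t<eZ ⟩
    2 * e Z        ≤⟨ *-monoʳ-≤ 2 (p⊆q⇒∣p∣≤∣q∣ within⊆gates) ⟩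
    2 * ∣ gates ∣  ∎)

-- Odd numbers in the form `3 + t * 2`.

odd≥3 : ∀ n → 3 ≤ n → n % 2 ≡ 1 → ∃[ t ] n ≡ 3 + t * 2
odd≥3 n 3≤n n%2≡1 = halve (n / 2) (trans (m≡m%n+[m/n]*n n 2) (cong (_+ n / 2 * 2) n%2≡1))
  where
  halve : ∀ q → n ≡ 1 + q * 2 → ∃[ t ] n ≡ 3 + t * 2
  halve zero    n≡1 = contradiction (subst (3 ≤_) n≡1 3≤n) λ { (s≤s ()) }
  halve (suc t) n≡  = t , n≡

lemma11 : (n k : ℕ) → 3 ≤ n → n % 2 ≡ 1 → k ≡ n ∸ 2 →
    ¬ (Σ[ S ∈ (Fin k → Subset n) ] (((j : Fin k) → ∣ S j ∣ ≡ k) ×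
    ((x : Vec Bool n) → MAJ n x ≡ MAJ k (tabulate (λ (j : Fin k) → gate (S j) x)))))
lemma11 n k 3≤n n%2≡1 k≡n∸2 (S , ∣S∣≡k , correct) with odd≥3 n 3≤n n%2≡1
lemma11 n k 3≤n n%2≡1 refl  (S , ∣S∣≡k , correct) | t , refl = no-circuit t S ∣S∣≡k correct
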